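{- Let $k, r, a, b, m, n$ be integers satisfying $$k\geq 1,\quad 0\leq a\leq m,\quad n\geq km-r,\quad \max\{0,ka-r\}\leq b\leq n.$$ Let $L_{k,r}(a,b;m,n)$ be the set of lattice paths from $(a,b)$ to $(m,n)$ with unit steps $(1,0)$ and $(0,1)$ that stay weakly above the line $y=kx-r$. Then $$|L_{k,r}(a,b;m,n)|=\sum_{i=0}^{\lfloor\frac{b+r-ka}{k+1}\rfloor}(-1)^i\,\frac{n+r+1-km}{n+r+1-k(a+i)}\binom{m+n+r-(k+1)(a+i)}{m-a-i}\binom{b+r-k(a+i)}{i}.$$
   Context: Lattice paths use unit steps $(1,0)$ and $(0,1)$. A path stays weakly above the line $y=qx-r$ if every lattice point $(x,y)$ on it satisfies $y\geq qx-r$. $\lfloor x\rfloor$ is the largest integer not exceeding $x$. Binomial coefficients $\binom{N}{j}$ with $N\ge 0$ are the usual ones and equal $0$ when $j<0$ or $j>N$. -}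

module Defs where

open import Data.Integer using (ℤ; +_; +0; +[1+_]; -[1+_]; 1ℤ; -1ℤ; _+_; _*_; _-_; -_; _^_; _≥_)
open import Data.List using (List; []; _∷_; map; foldr; upTo)
open import Data.List.Relation.Unary.All using (All)
open import Data.Nat as ℕ using (ℕ)
open import Data.Nat.Combinatorics using (_C_)
open import Data.Product using (Σ; _×_; _,_)
open import Data.Rational as ℚ using (ℚ; 0ℚ)

Point : Set
Point = ℤ × ℤ

data LatticePath : Point → Point → Set where
  stop  : ∀ {p} → LatticePath p p
  east  : ∀ {x y q} → LatticePath (x + 1ℤ , y) q → LatticePath (x , y) q
  north : ∀ {x y q} → LatticePath (x , y + 1ℤ) q → LatticePath (x , y) q

-- All lattice points on the path, both endpoints included.
points : ∀ {p q} → LatticePath p q → List Point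
points {p} stop      = p ∷ []
points {p} (east s)  = p ∷ points s
points {p} (north s) = p ∷ points s

WeaklyAbove : (k r : ℤ) {p q : Point} → LatticePath p q → Set
WeaklyAbove k r s = All (λ (x , y) → y ≥ k * x - r) (points s)

-- WeaklyAbove is a proposition, so elements of L are counted as paths.
L : (k r a b m n : ℤ) → Set
L k r a b m n = Σ (LatticePath (a , b) (m , n)) (WeaklyAbove k r)

-- The quotient of two integers in ℚ, with the convention p ÷ 0 = 0.
infixl 7 _÷_
_÷_ : ℤ → ℤ → ℚ
p ÷ +0       = 0ℚ
p ÷ +[1+ d ] = p ℚ./ ℕ.suc d
p ÷ -[1+ d ] = (- p) ℚ./ ℕ.suc d

fromℤ : ℤ → ℚ
fromℤ p = p ℚ./ 1

-- N C j is already 0 for j > N.  The value 0 for negative N is a convention.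
binomial : ℤ → ℤ → ℤ
binomial (+ N)    (+ j)    = + (N C j)
binomial (+ N)    -[1+ _ ] = +0
binomial -[1+ _ ] _        = +0

-- f 0 + f 1 + ... + f h, empty when h is negative.
sumTo : ℤ → (ℕ → ℚ) → ℚ
sumTo (+ h)    f = foldr ℚ._+_ 0ℚ (map f (upTo (ℕ.suc h)))
sumTo -[1+ _ ] f = 0ℚ

-- For 0 ≤ i ≤ ⌊(b + r - ka)/(k + 1)⌋ and k ≥ 1, a ≤ m, b ≤ n, one has
-- b + r - k(a + i) ≥ i, hence the denominator is ≥ 1 and the upper entries of
-- both binomials are ≥ 0: the conventions for _÷_ and binomial play no role.
term : (k r a b m n : ℤ) → ℕ → ℚ
term k r a b m n i =
  fromℤ (-1ℤ ^ i)
    ℚ.* ((n + r + 1ℤ - k * m) ÷ (n + r + 1ℤ - k * (a + + i)))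
    ℚ.* fromℤ (binomial (m + n + r - (k + 1ℤ) * (a + + i)) (m - a - + i))
    ℚ.* fromℤ (binomial (b + r - k * (a + + i)) (+ i))

{-# OPTIONS --safe #-}
-- Let h(x, y) = y + r - k x, so that an east step lowers h by k and a north step
-- raises it by 1.  With c = h(a, b), d = h(m, n), e = m - a, the claimed value is
--   G(c, e) = Σ_{i+j=e} (-1)^i A(j) C(c - k i, i),
--   A(j) = (d + 1) / (d + 1 + k j) C(d + (k + 1) j, j),
-- and A(j) is an integer.  Pascal's rule gives G(c, e) = G(c + 1, e) + G(c - k, e - 1),
-- which is the recursion of the path count by its first step.  On the line y = n, where
-- no north step is left, this requires G(d + k e + 1, e) = 0 for e > 0.  There
--   e A(j) C(d + 1 + k j, i) = (d + 1) C(e, i) C(d + (k + 1) j, e - 1),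
-- so e G is, up to the factor d + 1, the e-th difference of a polynomial in j of
-- degree e - 1, hence 0.
module Submission where

open import Defs
open import Data.Fin using (Fin)
open import Data.Fin.Properties using (+↔⊎; 1↔⊤)
open import Data.Integer using (ℤ; +_; -[1+_]; 0ℤ; 1ℤ; -1ℤ; _+_; _*_; _-_; -_; _^_; _⊔_; ∣_∣; _≤_; _≥_; +≤+)
open import Data.Integer.GCD using (gcd)
open import Data.Integer.Properties as ℤₚ using (pos-+; pos-*)
open import Data.Integer.Tactic.RingSolver using (solve-∀)
open import Data.List.Base using (foldr; applyUpTo)
open import Data.List.Properties using (map-upTo)
open import Data.List.Relation.Unary.All using ([]; _∷_)
open import Data.Nat as ℕ using (ℕ; zero; suc; _!; _∸_; s≤s; z≤n)
open import Data.Nat.Combinatorics using (_C_; nCk≡n!/k![n-k]!; k![n∸k]!∣n!; k>n⇒nCk≡0; nCk+nC[k+1]≡[n+1]C[k+1])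
open import Data.Nat.DivMod using (m/n*n≡m; m*n/o*n≡m/o; m/n*n≤m; m*n/n≡m; /-monoˡ-≤; /-congʳ; /-congˡ)
open import Data.Nat.Properties as ℕₚ using (_!*_!≢0)
import Data.Nat.Tactic.RingSolver as ℕ-Solver
open import Data.Product using (Σ-syntax; ∃-syntax; _×_; _,_; proj₁; proj₂)
open import Data.Rational as ℚ using (0ℚ; mkℚ; floor; ↥_; ↧_; toℚᵘ)
import Data.Rational.Properties as ℚₚ
open import Data.Rational.Unnormalised as ℚᵘ using (mkℚᵘ; *≡*)
import Data.Rational.Unnormalised.Properties as ℚᵘₚ
open import Data.Sum using (_⊎_; inj₁; inj₂)
open import Data.Sum.Function.Propositional using (_⊎-↔_)
open import Data.Unit using (tt)
open import Function.Base using (_∘_)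
open import Function.Bundles using (_↔_; mk↔ₛ′)
open import Function.Construct.Composition using (_↔-∘_)
open import Function.Construct.Symmetry using (↔-sym)
open import Relation.Binary.PropositionalEquality using (_≡_; _≢_; _≗_; refl; sym; trans; cong; cong₂; subst; subst₂; module ≡-Reasoning)
open import Relation.Nullary using (¬_; contradiction)

-- Integers inside the rationals, and bounds from division with remainder

fromℤ-+ : ∀ p q → fromℤ (p + q) ≡ fromℤ p ℚ.+ fromℤ q
fromℤ-+ p q = ℚₚ.toℚᵘ-injective (begin
  toℚᵘ (fromℤ (p + q))                 ≈⟨ ℚₚ.toℚᵘ-fromℚᵘ (mkℚᵘ (p + q) 0) ⟩
  mkℚᵘ (p + q) 0                       ≈⟨ *≡* (units p q) ⟩
  mkℚᵘ p 0 ℚᵘ.+ mkℚᵘ q 0               ≈⟨ ℚᵘₚ.+-cong (ℚₚ.toℚᵘ-fromℚᵘ (mkℚᵘ p 0)) (ℚₚ.toℚᵘ-fromℚᵘ (mkℚᵘ q 0)) ⟨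
  toℚᵘ (fromℤ p) ℚᵘ.+ toℚᵘ (fromℤ q)   ≈⟨ ℚₚ.toℚᵘ-homo-+ (fromℤ p) (fromℤ q) ⟨
  toℚᵘ (fromℤ p ℚ.+ fromℤ q)           ∎)
  where
  open ℚᵘₚ.≃-Reasoning
  units : ∀ p q → (p + q) * 1ℤ ≡ (p * 1ℤ + q * 1ℤ) * 1ℤ
  units = solve-∀

-- Cross-multiplication turns a division-free identity such as `raney-C` into one about a quotient;
-- `q = 0` yields the multiplicativity of `fromℤ`.
/-*-fromℤ : ∀ p q x y → p * x ≡ + suc q * y → (p ℚ./ suc q) ℚ.* fromℤ x ≡ fromℤ y
/-*-fromℤ p q x y px≡qy = ℚₚ.toℚᵘ-injective (begin
  toℚᵘ ((p ℚ./ suc q) ℚ.* fromℤ x)           ≈⟨ ℚₚ.toℚᵘ-homo-* (p ℚ./ suc q) (fromℤ x) ⟩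
  toℚᵘ (p ℚ./ suc q) ℚᵘ.* toℚᵘ (fromℤ x)     ≈⟨ ℚᵘₚ.*-cong (ℚₚ.toℚᵘ-fromℚᵘ (mkℚᵘ p q)) (ℚₚ.toℚᵘ-fromℚᵘ (mkℚᵘ x 0)) ⟩
  mkℚᵘ p q ℚᵘ.* mkℚᵘ x 0                     ≈⟨ *≡* cross ⟩
  mkℚᵘ y 0                                   ≈⟨ ℚₚ.toℚᵘ-fromℚᵘ (mkℚᵘ y 0) ⟨
  toℚᵘ (fromℤ y)                             ∎)
  where
  open ℚᵘₚ.≃-Reasoning
  cross : p * x * 1ℤ ≡ y * + (suc q ℕ.* 1)
  cross = trans (ℤₚ.*-identityʳ (p * x)) (trans px≡qy
    (trans (ℤₚ.*-comm (+ suc q) y) (cong (λ z → y * + z) (sym (ℕₚ.*-identityʳ (suc q))))))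

fromℤ-* : ∀ p q → fromℤ p ℚ.* fromℤ q ≡ fromℤ (p * q)
fromℤ-* p q = /-*-fromℤ p 0 q (p * q) (sym (ℤₚ.*-identityˡ (p * q)))

-- Ensures that `c ∸ k * i` is a genuine difference throughout the range of summation.
i≤c/[1+k]⇒ki≤c : ∀ c k {i} → i ℕ.≤ c ℕ./ suc k → k ℕ.* i ℕ.≤ c
i≤c/[1+k]⇒ki≤c c k {i} i≤c/[1+k] = begin
  k ℕ.* i                  ≤⟨ ℕₚ.m≤n+m (k ℕ.* i) i ⟩
  suc k ℕ.* i              ≡⟨ ℕₚ.*-comm (suc k) i ⟩
  i ℕ.* suc k              ≤⟨ ℕₚ.*-monoˡ-≤ (suc k) i≤c/[1+k] ⟩
  c ℕ./ suc k ℕ.* suc k    ≤⟨ m/n*n≤m c (suc k) ⟩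
  c                        ∎
  where open ℕₚ.≤-Reasoning

-- Past the range of summation the upper entry `c - k i` falls below `i`, so the second binomial
-- vanishes.
c/[1+k]<i⇒c<ki+i : ∀ c k {i} → c ℕ./ suc k ℕ.< i → c ℕ.< k ℕ.* i ℕ.+ i
c/[1+k]<i⇒c<ki+i c k {i} c/[1+k]<i = ℕₚ.≰⇒> λ ki+i≤c → ℕₚ.<⇒≱ c/[1+k]<i (begin
  i                           ≡⟨ m*n/n≡m i (suc k) ⟨
  (i ℕ.* suc k) ℕ./ suc k     ≡⟨ /-congˡ (trans (ℕₚ.*-comm i (suc k)) (ℕₚ.+-comm i (k ℕ.* i))) ⟩
  (k ℕ.* i ℕ.+ i) ℕ./ suc k   ≤⟨ /-monoˡ-≤ (suc k) ki+i≤c ⟩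
  c ℕ./ suc k                 ∎)
  where open ℕₚ.≤-Reasoning

open ≡-Reasoning

-- Binomial coefficients

C-factorial : ∀ x y → ((x ℕ.+ y) C y) ℕ.* (x ! ℕ.* y !) ≡ (x ℕ.+ y) !
C-factorial x y = begin
  ((x ℕ.+ y) C y) ℕ.* (x ! ℕ.* y !)
    ≡⟨ cong (((x ℕ.+ y) C y) ℕ.*_) (ℕₚ.*-comm (x !) (y !)) ⟩
  ((x ℕ.+ y) C y) ℕ.* (y ! ℕ.* x !)
    ≡⟨ cong (λ z → ((x ℕ.+ y) C y) ℕ.* (y ! ℕ.* z !)) (ℕₚ.m+n∸n≡m x y) ⟨
  ((x ℕ.+ y) C y) ℕ.* (y ! ℕ.* (x ℕ.+ y ℕ.∸ y) !)
    ≡⟨ cong (ℕ._* (y ! ℕ.* (x ℕ.+ y ℕ.∸ y) !)) (nCk≡n!/k![n-k]! y≤x+y) ⟩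
  _ ≡⟨ m/n*n≡m (k![n∸k]!∣n! y≤x+y) ⟩
  (x ℕ.+ y) ! ∎
  where
  y≤x+y = ℕₚ.m≤n+m y x
  instance _ = y !* (x ℕ.+ y ℕ.∸ y) !≢0

-- Both sides are `(q + j + 1)! / (q! j!)`.
C-sucʳ : ∀ q j → suc q ℕ.* ((q ℕ.+ suc j) C j) ≡ suc j ℕ.* ((q ℕ.+ suc j) C suc j)
C-sucʳ q j = ℕₚ.*-cancelʳ-≡ _ _ (q ! ℕ.* j !) (begin
  suc q ℕ.* ((q ℕ.+ suc j) C j) ℕ.* (q ! ℕ.* j !)
    ≡⟨ l₁ (suc q) ((q ℕ.+ suc j) C j) (q !) (j !) ⟩
  ((q ℕ.+ suc j) C j) ℕ.* (suc q ! ℕ.* j !)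
    ≡⟨ cong (λ z → (z C j) ℕ.* (suc q ! ℕ.* j !)) (ℕₚ.+-suc q j) ⟩
  ((suc q ℕ.+ j) C j) ℕ.* (suc q ! ℕ.* j !)
    ≡⟨ C-factorial (suc q) j ⟩
  (suc q ℕ.+ j) !
    ≡⟨ cong _! (ℕₚ.+-suc q j) ⟨
  (q ℕ.+ suc j) !
    ≡⟨ C-factorial q (suc j) ⟨
  ((q ℕ.+ suc j) C suc j) ℕ.* (q ! ℕ.* suc j !)
    ≡⟨ l₂ (suc j) ((q ℕ.+ suc j) C suc j) (q !) (j !) ⟩
  suc j ℕ.* ((q ℕ.+ suc j) C suc j) ℕ.* (q ! ℕ.* j !) ∎)
  where
  instance _ = q !* j !≢0
  l₁ : ∀ a b c d → a ℕ.* b ℕ.* (c ℕ.* d) ≡ b ℕ.* ((a ℕ.* c) ℕ.* d)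
  l₁ = ℕ-Solver.solve-∀
  l₂ : ∀ a b c d → b ℕ.* (c ℕ.* (a ℕ.* d)) ≡ a ℕ.* b ℕ.* (c ℕ.* d)
  l₂ = ℕ-Solver.solve-∀

-- For `i ≤ q + 1` put `l = q + 1 - i`. Then `l + e = q + j`, and both sides are
-- `(q + 1) (e + 1) (q + j)! / (i! j! l!)`.
C-rotate : ∀ q e i j → i ℕ.+ j ≡ suc e →
  suc e ℕ.* (((q ℕ.+ j) C j) ℕ.* (suc q C i)) ≡ suc q ℕ.* ((suc e C i) ℕ.* ((q ℕ.+ j) C e))
C-rotate q e i j i+j≡1+e with ℕₚ.≤-<-connex i (suc q)
-- Both sides are 0: the right one because `i + j = e + 1` now forces `q + j < e`.
... | inj₂ 1+q<i = begin
  suc e ℕ.* (((q ℕ.+ j) C j) ℕ.* (suc q C i))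
    ≡⟨ cong (λ z → suc e ℕ.* (((q ℕ.+ j) C j) ℕ.* z)) (k>n⇒nCk≡0 1+q<i) ⟩
  suc e ℕ.* (((q ℕ.+ j) C j) ℕ.* 0)
    ≡⟨ zero₁ (suc e) ((q ℕ.+ j) C j) (suc q) (suc e C i) ⟩
  suc q ℕ.* ((suc e C i) ℕ.* 0)
    ≡⟨ cong (λ z → suc q ℕ.* ((suc e C i) ℕ.* z)) (k>n⇒nCk≡0 q+j<e) ⟨
  suc q ℕ.* ((suc e C i) ℕ.* ((q ℕ.+ j) C e)) ∎
  where
  q+j<e : q ℕ.+ j ℕ.< e
  q+j<e = ℕₚ.≤-pred (ℕₚ.≤-trans (ℕₚ.+-monoˡ-≤ j 1+q<i) (ℕₚ.≤-reflexive i+j≡1+e))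
  zero₁ : ∀ a b c d → a ℕ.* (b ℕ.* 0) ≡ c ℕ.* (d ℕ.* 0)
  zero₁ = ℕ-Solver.solve-∀
... | inj₁ i≤1+q with ℕₚ.m≤n⇒∃[o]m+o≡n i≤1+q
... | l , i+l≡1+q = ℕₚ.*-cancelʳ-≡ _ _ ((q ! ℕ.* j !) ℕ.* (l ! ℕ.* i !)) (begin
  suc e ℕ.* (((q ℕ.+ j) C j) ℕ.* (suc q C i)) ℕ.* ((q ! ℕ.* j !) ℕ.* (l ! ℕ.* i !))
    ≡⟨ l₁ (suc e) ((q ℕ.+ j) C j) (suc q C i) (q ! ℕ.* j !) (l ! ℕ.* i !) ⟩
  suc e ℕ.* ((((q ℕ.+ j) C j) ℕ.* (q ! ℕ.* j !)) ℕ.* ((suc q C i) ℕ.* (l ! ℕ.* i !)))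
    ≡⟨ cong₂ (λ y z → suc e ℕ.* (y ℕ.* z)) (C-factorial q j) [1+q]Ci ⟩
  suc e ℕ.* ((q ℕ.+ j) ! ℕ.* suc q !)
    ≡⟨ l₂ (suc e) ((q ℕ.+ j) !) (suc q) (q !) ⟩
  suc q ℕ.* (q ! ℕ.* (suc e ℕ.* (q ℕ.+ j) !))
    ≡⟨ cong (λ z → suc q ℕ.* (q ! ℕ.* (suc e ℕ.* z))) [q+j]Ce ⟨
  suc q ℕ.* (q ! ℕ.* (suc e ℕ.* (((q ℕ.+ j) C e) ℕ.* (l ! ℕ.* e !))))
    ≡⟨ l₃ (suc q) (q !) (suc e) ((q ℕ.+ j) C e) (l !) (e !) ⟩
  suc q ℕ.* (q ! ℕ.* ((suc e !) ℕ.* (((q ℕ.+ j) C e) ℕ.* l !)))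
    ≡⟨ cong (λ z → suc q ℕ.* (q ! ℕ.* (z ℕ.* (((q ℕ.+ j) C e) ℕ.* l !)))) [1+e]Ci ⟨
  suc q ℕ.* (q ! ℕ.* (((suc e C i) ℕ.* (j ! ℕ.* i !)) ℕ.* (((q ℕ.+ j) C e) ℕ.* l !)))
    ≡⟨ l₄ (suc q) (q !) (suc e C i) (j !) (i !) ((q ℕ.+ j) C e) (l !) ⟩
  suc q ℕ.* ((suc e C i) ℕ.* ((q ℕ.+ j) C e)) ℕ.* ((q ! ℕ.* j !) ℕ.* (l ! ℕ.* i !)) ∎)
  where
  instance
    _ = q !* j !≢0
    _ = l !* i !≢0
    _ = ℕₚ.m*n≢0 (q ! ℕ.* j !) (l ! ℕ.* i !)
  l+i≡1+q : l ℕ.+ i ≡ suc q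
  l+i≡1+q = trans (ℕₚ.+-comm l i) i+l≡1+q
  [1+q]Ci : (suc q C i) ℕ.* (l ! ℕ.* i !) ≡ suc q !
  [1+q]Ci = subst (λ z → (z C i) ℕ.* (l ! ℕ.* i !) ≡ z !) l+i≡1+q (C-factorial l i)
  [1+e]Ci : (suc e C i) ℕ.* (j ! ℕ.* i !) ≡ suc e !
  [1+e]Ci = subst (λ z → (z C i) ℕ.* (j ! ℕ.* i !) ≡ z !) (trans (ℕₚ.+-comm j i) i+j≡1+e) (C-factorial j i)
  l+e≡q+j : l ℕ.+ e ≡ q ℕ.+ j
  l+e≡q+j = ℕₚ.suc-injective (begin
    suc (l ℕ.+ e)  ≡⟨ ℕₚ.+-suc l e ⟨
    l ℕ.+ suc e    ≡⟨ cong (l ℕ.+_) i+j≡1+e ⟨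
    l ℕ.+ (i ℕ.+ j)  ≡⟨ ℕₚ.+-assoc l i j ⟨
    l ℕ.+ i ℕ.+ j    ≡⟨ cong (ℕ._+ j) l+i≡1+q ⟩
    suc q ℕ.+ j    ∎)
  [q+j]Ce : ((q ℕ.+ j) C e) ℕ.* (l ! ℕ.* e !) ≡ (q ℕ.+ j) !
  [q+j]Ce = subst (λ z → (z C e) ℕ.* (l ! ℕ.* e !) ≡ z !) l+e≡q+j (C-factorial l e)
  l₁ : ∀ a b c x y → a ℕ.* (b ℕ.* c) ℕ.* (x ℕ.* y) ≡ a ℕ.* ((b ℕ.* x) ℕ.* (c ℕ.* y))
  l₁ = ℕ-Solver.solve-∀
  l₂ : ∀ a b c d → a ℕ.* (b ℕ.* (c ℕ.* d)) ≡ c ℕ.* (d ℕ.* (a ℕ.* b))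
  l₂ = ℕ-Solver.solve-∀
  l₃ : ∀ a b c d f g → a ℕ.* (b ℕ.* (c ℕ.* (d ℕ.* (f ℕ.* g)))) ≡ a ℕ.* (b ℕ.* ((c ℕ.* g) ℕ.* (d ℕ.* f)))
  l₃ = ℕ-Solver.solve-∀
  l₄ : ∀ a b c d f g h → a ℕ.* (b ℕ.* ((c ℕ.* (d ℕ.* f)) ℕ.* (g ℕ.* h))) ≡ a ℕ.* (c ℕ.* g) ℕ.* ((b ℕ.* d) ℕ.* (h ℕ.* f))
  l₄ = ℕ-Solver.solve-∀

-- Antidiagonal sums and finite differences

-- antidiagonal e f is the sum of f i j over all i + j ≡ e.
antidiagonal : ℕ → (ℕ → ℕ → ℤ) → ℤ
antidiagonal zero    f = f 0 0
antidiagonal (suc e) f = f 0 (suc e) + antidiagonal e (λ i j → f (suc i) j)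

antidiagonal-cong : ∀ e {f g} → (∀ i j → i ℕ.+ j ≡ e → f i j ≡ g i j) →
  antidiagonal e f ≡ antidiagonal e g
antidiagonal-cong zero    f≗g = f≗g 0 0 refl
antidiagonal-cong (suc e) f≗g =
  cong₂ _+_ (f≗g 0 (suc e) refl)
    (antidiagonal-cong e λ i j i+j≡e → f≗g (suc i) j (cong suc i+j≡e))

-- The definition peels off `i = 0`; peeling off `j = 0` instead exposes the shifted function in
-- `difference-suc`.
antidiagonal-last : ∀ e f →
  antidiagonal (suc e) f ≡ antidiagonal e (λ i j → f i (suc j)) + f (suc e) 0
antidiagonal-last zero    f = refl
antidiagonal-last (suc e) f = begin
  f 0 (2 ℕ.+ e) + antidiagonal (suc e) (λ i j → f (suc i) j)
    ≡⟨ cong (_+_ (f 0 (2 ℕ.+ e))) (antidiagonal-last e (λ i j → f (suc i) j)) ⟩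
  f 0 (2 ℕ.+ e) + (antidiagonal e (λ i j → f (suc i) (suc j)) + f (2 ℕ.+ e) 0)
    ≡⟨ ℤₚ.+-assoc (f 0 (2 ℕ.+ e)) _ _ ⟨
  f 0 (2 ℕ.+ e) + antidiagonal e (λ i j → f (suc i) (suc j)) + f (2 ℕ.+ e) 0 ∎

antidiagonal-+ : ∀ e f g →
  antidiagonal e (λ i j → f i j + g i j) ≡ antidiagonal e f + antidiagonal e g
antidiagonal-+ zero    f g = refl
antidiagonal-+ (suc e) f g = begin
  f 0 (suc e) + g 0 (suc e) + antidiagonal e (λ i j → f (suc i) j + g (suc i) j)
    ≡⟨ cong (_+_ (f 0 (suc e) + g 0 (suc e))) (antidiagonal-+ e (λ i j → f (suc i) j) (λ i j → g (suc i) j)) ⟩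
  _ ≡⟨ interchange (f 0 (suc e)) (g 0 (suc e)) _ _ ⟩
  antidiagonal (suc e) f + antidiagonal (suc e) g ∎
  where
  interchange : ∀ a b c d → a + b + (c + d) ≡ a + c + (b + d)
  interchange = solve-∀

antidiagonal-* : ∀ e c f →
  antidiagonal e (λ i j → c * f i j) ≡ c * antidiagonal e f
antidiagonal-* zero    c f = refl
antidiagonal-* (suc e) c f = begin
  c * f 0 (suc e) + antidiagonal e (λ i j → c * f (suc i) j)
    ≡⟨ cong (_+_ (c * f 0 (suc e))) (antidiagonal-* e c (λ i j → f (suc i) j)) ⟩
  c * f 0 (suc e) + c * antidiagonal e (λ i j → f (suc i) j)
    ≡⟨ ℤₚ.*-distribˡ-+ c _ _ ⟨
  c * antidiagonal (suc e) f ∎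

pascal : ∀ n i → + (suc n C suc i) ≡ + (n C i) + + (n C suc i)
pascal n i = cong +_ (sym (nCk+nC[k+1]≡[n+1]C[k+1] n i))

-- The e-th forward difference of f at 0.
difference : ℕ → (ℕ → ℤ) → ℤ
difference e f = antidiagonal e (λ i j → -1ℤ ^ i * + (e C i) * f j)

difference-cong : ∀ e {f g} → f ≗ g → difference e f ≡ difference e g
difference-cong e f≗g =
  antidiagonal-cong e λ i j _ → cong (-1ℤ ^ i * + (e C i) *_) (f≗g j)

difference-+ : ∀ e f g →
  difference e (λ j → f j + g j) ≡ difference e f + difference e g
difference-+ e f g = begin
  difference e (λ j → f j + g j)
    ≡⟨ antidiagonal-cong e (λ i j _ → ℤₚ.*-distribˡ-+ (-1ℤ ^ i * + (e C i)) (f j) (g j)) ⟩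
  _ ≡⟨ antidiagonal-+ e (λ i j → -1ℤ ^ i * + (e C i) * f j) (λ i j → -1ℤ ^ i * + (e C i) * g j) ⟩
  difference e f + difference e g ∎

-- Pascal's rule splits `C(e + 1, i + 1)`. The parts with `C(e, i)` carry one more sign and give
-- `- difference e f`; the others, peeled from the far end, give the difference of the shift and a
-- term with `C(e, e + 1) = 0`.
difference-suc : ∀ e f →
  difference (suc e) f ≡ difference e (λ j → f (suc j)) - difference e f
difference-suc e f = begin
  t 0 (suc e) + antidiagonal e (λ i j → -1ℤ ^ suc i * + (suc e C suc i) * f j)
    ≡⟨ cong (_+_ (t 0 (suc e))) (antidiagonal-cong e λ i j _ → split i j) ⟩
  t 0 (suc e) + antidiagonal e (λ i j → -1ℤ * t i j + t (suc i) j)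
    ≡⟨ cong (_+_ (t 0 (suc e))) (antidiagonal-+ e (λ i j → -1ℤ * t i j) (λ i j → t (suc i) j)) ⟩
  t 0 (suc e) + (antidiagonal e (λ i j → -1ℤ * t i j) + antidiagonal e (λ i j → t (suc i) j))
    ≡⟨ cong (λ z → t 0 (suc e) + (z + antidiagonal e (λ i j → t (suc i) j))) (antidiagonal-* e -1ℤ t) ⟩
  t 0 (suc e) + (-1ℤ * difference e f + antidiagonal e (λ i j → t (suc i) j))
    ≡⟨ regroup (t 0 (suc e)) (difference e f) _ ⟩
  antidiagonal (suc e) t - difference e f
    ≡⟨ cong (_- difference e f) (antidiagonal-last e t) ⟩
  difference e (λ j → f (suc j)) + t (suc e) 0 - difference e f
    ≡⟨ cong (λ z → difference e (λ j → f (suc j)) + z - difference e f) t-last ⟩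
  difference e (λ j → f (suc j)) + 0ℤ - difference e f
    ≡⟨ cong (_- difference e f) (ℤₚ.+-identityʳ (difference e (λ j → f (suc j)))) ⟩
  difference e (λ j → f (suc j)) - difference e f ∎
  where
  t : ℕ → ℕ → ℤ
  t i j = -1ℤ ^ i * + (e C i) * f j

  distrib : ∀ s x y z → -1ℤ * s * (x + y) * z ≡ -1ℤ * (s * x * z) + -1ℤ * s * y * z
  distrib = solve-∀

  split : ∀ i j → -1ℤ ^ suc i * + (suc e C suc i) * f j ≡ -1ℤ * t i j + t (suc i) j
  split i j = trans
    (cong (λ z → -1ℤ ^ suc i * z * f j) (pascal e i))
    (distrib (-1ℤ ^ i) (+ (e C i)) (+ (e C suc i)) (f j))

  regroup : ∀ x y z → x + (-1ℤ * y + z) ≡ x + z - y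
  regroup = solve-∀

  t-last : t (suc e) 0 ≡ 0ℤ
  t-last = begin
    -1ℤ ^ suc e * + (e C suc e) * f 0
      ≡⟨ cong (λ z → -1ℤ ^ suc e * + z * f 0) (k>n⇒nCk≡0 (ℕₚ.n<1+n e)) ⟩
    -1ℤ ^ suc e * 0ℤ * f 0
      ≡⟨ cong (_* f 0) (ℤₚ.*-zeroʳ (-1ℤ ^ suc e)) ⟩
    0ℤ ∎

difference-suc≡0 : ∀ e f → difference e (λ j → f (suc j)) ≡ difference e f →
  difference (suc e) f ≡ 0ℤ
difference-suc≡0 e f eq = begin
  difference (suc e) f                              ≡⟨ difference-suc e f ⟩
  difference e (λ j → f (suc j)) - difference e f   ≡⟨ ℤₚ.i≡j⇒i-j≡0 eq ⟩
  0ℤ                                                ∎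

-- j ↦ (x + s j) C t is a polynomial of degree t in j.
difference-C : ∀ e t x s → t ℕ.< e →
  difference e (λ j → + ((x ℕ.+ s ℕ.* j) C t)) ≡ 0ℤ
difference-C (suc e) zero    x s _         = difference-suc≡0 e (λ j → 1ℤ) refl
difference-C (suc e) (suc t) x s (s≤s t<e) =
  difference-suc≡0 e (λ j → + ((x ℕ.+ s ℕ.* j) C suc t)) (begin
    difference e (λ j → + ((x ℕ.+ s ℕ.* suc j) C suc t))
      ≡⟨ difference-cong e (λ j → cong (λ z → + (z C suc t)) (x+s[1+j] j)) ⟩
    difference e (λ j → + ((s ℕ.+ x ℕ.+ s ℕ.* j) C suc t))
      ≡⟨ translate s ⟩
    difference e (λ j → + ((x ℕ.+ s ℕ.* j) C suc t)) ∎)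
  where
  x+s[1+j] : ∀ j → x ℕ.+ s ℕ.* suc j ≡ s ℕ.+ x ℕ.+ s ℕ.* j
  x+s[1+j] j = begin
    x ℕ.+ s ℕ.* suc j      ≡⟨ cong (x ℕ.+_) (ℕₚ.*-suc s j) ⟩
    x ℕ.+ (s ℕ.+ s ℕ.* j)  ≡⟨ ℕₚ.+-assoc x s _ ⟨
    x ℕ.+ s ℕ.+ s ℕ.* j    ≡⟨ cong (ℕ._+ s ℕ.* j) (ℕₚ.+-comm x s) ⟩
    s ℕ.+ x ℕ.+ s ℕ.* j    ∎

  -- The shift by `s` is made one unit at a time. By Pascal's rule each unit adds a binomial with
  -- lower entry `t`, whose `e`-th difference is 0 by induction.
  translate : ∀ u → difference e (λ j → + ((u ℕ.+ x ℕ.+ s ℕ.* j) C suc t))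
                  ≡ difference e (λ j → + ((x ℕ.+ s ℕ.* j) C suc t))
  translate zero    = refl
  translate (suc u) = begin
    difference e (λ j → + ((suc u ℕ.+ x ℕ.+ s ℕ.* j) C suc t))
      ≡⟨ difference-cong e (λ j → pascal (u ℕ.+ x ℕ.+ s ℕ.* j) t) ⟩
    difference e (λ j → + ((u ℕ.+ x ℕ.+ s ℕ.* j) C t) + + ((u ℕ.+ x ℕ.+ s ℕ.* j) C suc t))
      ≡⟨ difference-+ e (λ j → + ((u ℕ.+ x ℕ.+ s ℕ.* j) C t)) _ ⟩
    difference e (λ j → + ((u ℕ.+ x ℕ.+ s ℕ.* j) C t))
      + difference e (λ j → + ((u ℕ.+ x ℕ.+ s ℕ.* j) C suc t))
      ≡⟨ cong₂ _+_ (difference-C e t (u ℕ.+ x) s t<e) (translate u) ⟩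
    0ℤ + difference e (λ j → + ((x ℕ.+ s ℕ.* j) C suc t))
      ≡⟨ ℤₚ.+-identityˡ _ ⟩
    difference e (λ j → + ((x ℕ.+ s ℕ.* j) C suc t)) ∎

-- Raney numbers and the alternating sum

module _ (k d : ℕ) where

  -- The Raney number (d + 1) / (d + 1 + k j) * (d + (k + 1) j) C j without division.
  raney : ℕ → ℤ
  raney zero      = 1ℤ
  raney j@(suc i) = + ((d ℕ.+ k ℕ.* j ℕ.+ j) C j) - + k * + ((d ℕ.+ k ℕ.* j ℕ.+ j) C i)

  -- With `q = d + k j`, `C-sucʳ` gives `(q + 1) C(q + j, j - 1) = j C(q + j, j)`, so the left side
  -- is `(q + 1 - k j) C(q + j, j)`.
  raney-C : ∀ j → + suc (d ℕ.+ k ℕ.* j) * raney j ≡ + suc d * + ((d ℕ.+ k ℕ.* j ℕ.+ j) C j)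
  raney-C zero      = cong (λ z → + suc z * 1ℤ) (trans (cong (d ℕ.+_) (ℕₚ.*-zeroʳ k)) (ℕₚ.+-identityʳ d))
  raney-C j@(suc i) = begin
    + suc q * (x - + k * y)
      ≡⟨ distrib (+ suc q) x (+ k) y ⟩
    + suc q * x - + k * (+ suc q * y)
      ≡⟨ cong (λ z → + suc q * x - + k * z) [1+q]y≡jx ⟩
    + suc q * x - + k * (+ j * x)
      ≡⟨ cong (λ z → z * x - + k * (+ j * x)) (trans (pos-+ (suc d) (k ℕ.* j)) (cong (_+_ (+ suc d)) (pos-* k j))) ⟩
    (+ suc d + + k * + j) * x - + k * (+ j * x)
      ≡⟨ cancel (+ suc d) (+ k) (+ j) x ⟩
    + suc d * x ∎
    where
    q = d ℕ.+ k ℕ.* j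
    x = + ((q ℕ.+ j) C j)
    y = + ((q ℕ.+ j) C i)
    [1+q]y≡jx : + suc q * y ≡ + j * x
    [1+q]y≡jx = begin
      + suc q * y                  ≡⟨ pos-* (suc q) _ ⟨
      + (suc q ℕ.* ((q ℕ.+ j) C i)) ≡⟨ cong +_ (C-sucʳ q i) ⟩
      + (j ℕ.* ((q ℕ.+ j) C j))     ≡⟨ pos-* j _ ⟩
      + j * x                      ∎
    distrib : ∀ a b c d → a * (b - c * d) ≡ a * b - c * (a * d)
    distrib = solve-∀
    cancel : ∀ a b c d → (a + b * c) * d - b * (c * d) ≡ a * d
    cancel = solve-∀

  -- Truncation is harmless: if c < k * i then i > 0, so 0 C i vanishes as it should.
  summand : ℕ → ℕ → ℕ → ℤ
  summand c i j = -1ℤ ^ i * raney j * + ((c ∸ k ℕ.* i) C i)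

  altSum : ℕ → ℕ → ℤ
  altSum c e = antidiagonal e (summand c)

  -- The terms for `i = 0` agree. As `c + k - k (i + 1) = c - k i`, term `i` of `altSum c e` cancels
  -- one half of Pascal's rule in term `i + 1` of the first sum, its sign being opposite.
  altSum-pascal : ∀ c e → altSum (suc (c ℕ.+ k)) (suc e) + altSum c e ≡ altSum (c ℕ.+ k) (suc e)
  altSum-pascal c e = begin
    h + antidiagonal e (λ i → summand (suc (c ℕ.+ k)) (suc i)) + altSum c e
      ≡⟨ ℤₚ.+-assoc h _ _ ⟩
    h + (antidiagonal e (λ i → summand (suc (c ℕ.+ k)) (suc i)) + altSum c e)
      ≡⟨ cong (_+_ h) (antidiagonal-+ e (λ i → summand (suc (c ℕ.+ k)) (suc i)) (summand c)) ⟨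
    h + antidiagonal e (λ i j → summand (suc (c ℕ.+ k)) (suc i) j + summand c i j)
      ≡⟨ cong (_+_ h) (antidiagonal-cong e λ i j _ → step i j) ⟩
    h + antidiagonal e (λ i → summand (c ℕ.+ k) (suc i)) ∎
    where
    h = summand (c ℕ.+ k) 0 (suc e)

    shift : ∀ x i → x ℕ.+ k ∸ k ℕ.* suc i ≡ x ∸ k ℕ.* i
    shift x i = begin
      x ℕ.+ k ∸ k ℕ.* suc i       ≡⟨ cong₂ _∸_ (ℕₚ.+-comm x k) (ℕₚ.*-suc k i) ⟩
      k ℕ.+ x ∸ (k ℕ.+ k ℕ.* i)   ≡⟨ ℕₚ.[m+n]∸[m+o]≡n∸o k x (k ℕ.* i) ⟩
      x ∸ k ℕ.* i                 ∎

    -- Pascal's rule survives truncation: if `c < k * i`, then `i > 0`, both upper entries are 0 and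
    -- all three binomials vanish.
    C-step : ∀ i → (suc c ∸ k ℕ.* i) C suc i ≡ ((c ∸ k ℕ.* i) C i) ℕ.+ ((c ∸ k ℕ.* i) C suc i)
    C-step i with ℕₚ.≤-<-connex (k ℕ.* i) c
    ... | inj₁ ki≤c = trans (cong (_C suc i) (ℕₚ.+-∸-assoc 1 ki≤c)) (sym (nCk+nC[k+1]≡[n+1]C[k+1] _ i))
    C-step zero    | inj₂ c<ki with () ← ℕₚ.<⇒≱ c<ki (subst (ℕ._≤ c) (sym (ℕₚ.*-zeroʳ k)) z≤n)
    C-step (suc i) | inj₂ c<ki
      rewrite ℕₚ.m≤n⇒m∸n≡0 c<ki | ℕₚ.m≤n⇒m∸n≡0 (ℕₚ.<⇒≤ c<ki) = refl

    cancel : ∀ s a x y → -1ℤ * s * a * (x + y) + s * a * x ≡ -1ℤ * s * a * y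
    cancel = solve-∀

    step : ∀ i j → summand (suc (c ℕ.+ k)) (suc i) j + summand c i j ≡ summand (c ℕ.+ k) (suc i) j
    step i j = begin
      -1ℤ ^ suc i * raney j * + ((suc c ℕ.+ k ∸ k ℕ.* suc i) C suc i) + summand c i j
        ≡⟨ cong (λ z → -1ℤ ^ suc i * raney j * + z + summand c i j)
             (trans (cong (_C suc i) (shift (suc c) i)) (C-step i)) ⟩
      -1ℤ ^ suc i * raney j * + (((c ∸ k ℕ.* i) C i) ℕ.+ ((c ∸ k ℕ.* i) C suc i)) + summand c i j
        ≡⟨ cancel (-1ℤ ^ i) (raney j) (+ ((c ∸ k ℕ.* i) C i)) (+ ((c ∸ k ℕ.* i) C suc i)) ⟩
      -1ℤ ^ suc i * raney j * + ((c ∸ k ℕ.* i) C suc i)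
        ≡⟨ cong (λ z → -1ℤ ^ suc i * raney j * + (z C suc i)) (shift c i) ⟨
      summand (c ℕ.+ k) (suc i) j ∎

  -- For `i > 0` both upper entries truncate to 0. This is the recursion at heights where an east
  -- step would cross the line.
  altSum-const : ∀ c e → c ℕ.< k → altSum (suc c) e ≡ altSum c e
  altSum-const c e c<k = antidiagonal-cong e λ i j _ → step i j
    where
    step : ∀ i j → summand (suc c) i j ≡ summand c i j
    step zero    j = refl
    step (suc i) j = cong (λ z → -1ℤ ^ suc i * raney j * + (z C suc i))
      (trans (ℕₚ.m≤n⇒m∸n≡0 c<k[1+i]) (sym (ℕₚ.m≤n⇒m∸n≡0 (ℕₚ.<⇒≤ c<k[1+i]))))
      where
      c<k[1+i] : c ℕ.< k ℕ.* suc i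
      c<k[1+i] = ℕₚ.≤-trans c<k (ℕₚ.m≤m*n k (suc i))

  -- This is the height of a point just above `y = n`, from which no path reaches the end. The
  -- factor `e + 1` that `C-rotate` needs can be inserted because it is cancellable in the integers.
  altSum-beyond : ∀ e → altSum (suc (d ℕ.+ k ℕ.* suc e)) (suc e) ≡ 0ℤ
  altSum-beyond e = ℤₚ.*-cancelˡ-≡ (+ suc e) _ _ (begin
    + suc e * antidiagonal (suc e) (summand c)
      ≡⟨ antidiagonal-* (suc e) (+ suc e) (summand c) ⟨
    antidiagonal (suc e) (λ i j → + suc e * summand c i j)
      ≡⟨ antidiagonal-cong (suc e) rotate ⟩
    antidiagonal (suc e) (λ i j → + suc d * (-1ℤ ^ i * + (suc e C i) * + ((d ℕ.+ suc k ℕ.* j) C e)))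
      ≡⟨ antidiagonal-* (suc e) (+ suc d) (λ i j → -1ℤ ^ i * + (suc e C i) * + ((d ℕ.+ suc k ℕ.* j) C e)) ⟩
    + suc d * difference (suc e) (λ j → + ((d ℕ.+ suc k ℕ.* j) C e))
      ≡⟨ cong (+ suc d *_) (difference-C (suc e) e d (suc k) (ℕₚ.n<1+n e)) ⟩
    + suc d * 0ℤ
      ≡⟨ trans (ℤₚ.*-zeroʳ (+ suc d)) (sym (ℤₚ.*-zeroʳ (+ suc e))) ⟩
    + suc e * 0ℤ ∎)
    where
    c = suc (d ℕ.+ k ℕ.* suc e)

    rotate : ∀ i j → i ℕ.+ j ≡ suc e → + suc e * summand c i j
           ≡ + suc d * (-1ℤ ^ i * + (suc e C i) * + ((d ℕ.+ suc k ℕ.* j) C e))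
    -- The further factor `q + 1` is the denominator of the Raney number and, by `c∸ki≡1+q`, also
    -- the upper entry of the other binomial. `raney-C` consumes it and `C-rotate` restores it.
    rotate i j i+j≡1+e = ℤₚ.*-cancelˡ-≡ (+ suc q) _ _ (begin
      + suc q * (+ suc e * (-1ℤ ^ i * raney j * + ((c ∸ k ℕ.* i) C i)))
        ≡⟨ cong (λ z → + suc q * (+ suc e * (-1ℤ ^ i * raney j * + (z C i)))) c∸ki≡1+q ⟩
      + suc q * (+ suc e * (-1ℤ ^ i * raney j * + (suc q C i)))
        ≡⟨ l₁ (+ suc q) (+ suc e) (-1ℤ ^ i) (raney j) (+ (suc q C i)) ⟩
      (-1ℤ ^ i * + suc e) * ((+ suc q * raney j) * + (suc q C i))
        ≡⟨ cong (λ z → (-1ℤ ^ i * + suc e) * (z * + (suc q C i))) (raney-C j) ⟩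
      (-1ℤ ^ i * + suc e) * ((+ suc d * + ((q ℕ.+ j) C j)) * + (suc q C i))
        ≡⟨ l₂ (-1ℤ ^ i) (+ suc e) (+ suc d) (+ ((q ℕ.+ j) C j)) (+ (suc q C i)) ⟩
      (-1ℤ ^ i * + suc d) * (+ suc e * (+ ((q ℕ.+ j) C j) * + (suc q C i)))
        ≡⟨ cong ((-1ℤ ^ i * + suc d) *_) C-rotateℤ ⟩
      (-1ℤ ^ i * + suc d) * (+ suc q * (+ (suc e C i) * + ((q ℕ.+ j) C e)))
        ≡⟨ l₃ (-1ℤ ^ i) (+ suc d) (+ suc q) (+ (suc e C i)) (+ ((q ℕ.+ j) C e)) ⟩
      + suc q * (+ suc d * (-1ℤ ^ i * + (suc e C i) * + ((q ℕ.+ j) C e)))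
        ≡⟨ cong (λ z → + suc q * (+ suc d * (-1ℤ ^ i * + (suc e C i) * + (z C e)))) q+j≡d+[1+k]j ⟩
      + suc q * (+ suc d * (-1ℤ ^ i * + (suc e C i) * + ((d ℕ.+ suc k ℕ.* j) C e))) ∎)
      where
      q = d ℕ.+ k ℕ.* j

      c∸ki≡1+q : c ∸ k ℕ.* i ≡ suc q
      c∸ki≡1+q = begin
        suc (d ℕ.+ k ℕ.* suc e) ∸ k ℕ.* i
          ≡⟨ cong (λ z → suc (d ℕ.+ k ℕ.* z) ∸ k ℕ.* i) (trans (ℕₚ.+-comm j i) i+j≡1+e) ⟨
        suc (d ℕ.+ k ℕ.* (j ℕ.+ i)) ∸ k ℕ.* i
          ≡⟨ cong (λ z → suc (d ℕ.+ z) ∸ k ℕ.* i) (ℕₚ.*-distribˡ-+ k j i) ⟩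
        suc (d ℕ.+ (k ℕ.* j ℕ.+ k ℕ.* i)) ∸ k ℕ.* i
          ≡⟨ cong (λ z → suc z ∸ k ℕ.* i) (ℕₚ.+-assoc d _ _) ⟨
        suc q ℕ.+ k ℕ.* i ∸ k ℕ.* i
          ≡⟨ ℕₚ.m+n∸n≡m (suc q) (k ℕ.* i) ⟩
        suc q ∎

      q+j≡d+[1+k]j : q ℕ.+ j ≡ d ℕ.+ suc k ℕ.* j
      q+j≡d+[1+k]j = trans (ℕₚ.+-assoc d _ j) (cong (d ℕ.+_) (ℕₚ.+-comm (k ℕ.* j) j))

      pos-*³ : ∀ x y z → + (x ℕ.* (y ℕ.* z)) ≡ + x * (+ y * + z)
      pos-*³ x y z = trans (pos-* x (y ℕ.* z)) (cong (+ x *_) (pos-* y z))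

      C-rotateℤ : + suc e * (+ ((q ℕ.+ j) C j) * + (suc q C i))
                ≡ + suc q * (+ (suc e C i) * + ((q ℕ.+ j) C e))
      C-rotateℤ = begin
        + suc e * (+ ((q ℕ.+ j) C j) * + (suc q C i))
          ≡⟨ pos-*³ (suc e) ((q ℕ.+ j) C j) (suc q C i) ⟨
        + (suc e ℕ.* (((q ℕ.+ j) C j) ℕ.* (suc q C i)))
          ≡⟨ cong +_ (C-rotate q e i j i+j≡1+e) ⟩
        + (suc q ℕ.* ((suc e C i) ℕ.* ((q ℕ.+ j) C e)))
          ≡⟨ pos-*³ (suc q) (suc e C i) ((q ℕ.+ j) C e) ⟩
        + suc q * (+ (suc e C i) * + ((q ℕ.+ j) C e)) ∎

      l₁ : ∀ q e s a x → q * (e * (s * a * x)) ≡ (s * e) * ((q * a) * x)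
      l₁ = solve-∀
      l₂ : ∀ s e d x y → (s * e) * ((d * x) * y) ≡ (s * d) * (e * (x * y))
      l₂ = solve-∀
      l₃ : ∀ s d q x y → (s * d) * (q * (x * y)) ≡ q * (d * (s * x * y))
      l₃ = solve-∀

-- Counting paths

⊎-emptyˡ : {A B : Set} → ¬ A → (A ⊎ B) ↔ B
⊎-emptyˡ ¬A = mk↔ₛ′
  (λ { (inj₁ x) → contradiction x ¬A; (inj₂ y) → y }) inj₂ (λ _ → refl)
  (λ { (inj₁ x) → contradiction x ¬A; (inj₂ _) → refl })

⊎-emptyʳ : {A B : Set} → ¬ B → (A ⊎ B) ↔ A
⊎-emptyʳ ¬B = mk↔ₛ′
  (λ { (inj₁ x) → x; (inj₂ y) → contradiction y ¬B }) inj₁ (λ _ → refl)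
  (λ { (inj₁ _) → refl; (inj₂ y) → contradiction y ¬B })

-- The empty path corresponds to a proof that its endpoints agree; by uniqueness of identity proofs
-- there is just one.
≡↔Fin1 : {A : Set} {x y : A} → x ≡ y → (x ≡ y) ↔ Fin 1
≡↔Fin1 refl = ↔-sym 1↔⊤ ↔-∘ mk↔ₛ′ (λ _ → tt) (λ _ → refl) (λ _ → refl) (λ { refl → refl })

path-≤ : ∀ {x y m n} → LatticePath (x , y) (m , n) → x ≤ m × y ≤ n
path-≤ stop      = ℤₚ.≤-refl , ℤₚ.≤-refl
path-≤ (east {x} s) with path-≤ s
... | x+1≤m , y≤n = ℤₚ.≤-trans (ℤₚ.i≤i+j x 1ℤ) x+1≤m , y≤n
path-≤ (north {y = y} s) with path-≤ s
... | x≤m , y+1≤n = x≤m , ℤₚ.≤-trans (ℤₚ.i≤i+j y 1ℤ) y+1≤n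

L-start : ∀ {k r x y m n} → L k r x y m n → k * x - r ≤ y
L-start (stop    , p ∷ _) = p
L-start (east _  , p ∷ _) = p
L-start (north _ , p ∷ _) = p

-- The cases are the empty path and the two possible first steps. The inverse supplies `p` as the
-- bound at the start, and irrelevance of `≤` identifies it with the bound stored in the path.
L-unfold : ∀ {k r x y m n} → k * x - r ≤ y →
  L k r x y m n ↔ (((x , y) ≡ (m , n)) ⊎ (L k r (x + 1ℤ) y m n ⊎ L k r x (y + 1ℤ) m n))
L-unfold {k} {r} {x} {y} {m} {n} p = mk↔ₛ′ to from to∘from from∘to
  where
  to : L k r x y m n → _
  to (stop    , _)     = inj₁ refl
  to (east s  , _ ∷ u) = inj₂ (inj₁ (s , u))
  to (north s , _ ∷ u) = inj₂ (inj₂ (s , u))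
  from : _ → L k r x y m n
  from (inj₁ refl)           = stop , p ∷ []
  from (inj₂ (inj₁ (s , u))) = east s , p ∷ u
  from (inj₂ (inj₂ (s , u))) = north s , p ∷ u
  to∘from : ∀ z → to (from z) ≡ z
  to∘from (inj₁ refl)           = refl
  to∘from (inj₂ (inj₁ (s , u))) = refl
  to∘from (inj₂ (inj₂ (s , u))) = refl
  from∘to : ∀ z → from (to z) ≡ z
  from∘to (stop    , q ∷ []) = cong (λ q → stop , q ∷ []) (ℤₚ.≤-irrelevant p q)
  from∘to (east s  , q ∷ u)  = cong (λ q → east s , q ∷ u) (ℤₚ.≤-irrelevant p q)
  from∘to (north s , q ∷ u)  = cong (λ q → north s , q ∷ u) (ℤₚ.≤-irrelevant p q)

+-cancelˡ-≤ : ∀ i {j l} → i + j ≤ i + l → j ≤ l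
+-cancelˡ-≤ i {j} {l} p = subst₂ _≤_ (cancel i j) (cancel i l) (ℤₚ.+-monoʳ-≤ (- i) p)
  where
  cancel : ∀ i j → - i + (i + j) ≡ j
  cancel = solve-∀

i+[1+j]≰i : ∀ i j → ¬ (i + + suc j ≤ i)
i+[1+j]≰i i j p with +-cancelˡ-≤ i {l = 0ℤ} (ℤₚ.≤-trans p (ℤₚ.≤-reflexive (sym (ℤₚ.+-identityʳ i))))
... | +≤+ ()

-- The value is an integer because the sums are signed; its being a natural number comes out of the
-- induction.
Counted : Set → ℤ → Set
Counted A z = Σ[ N ∈ ℕ ] (A ↔ Fin N) × + N ≡ z

Counted-⊎ : ∀ {A B v w} → Counted A v → Counted B w → Counted (A ⊎ B) (v + w)
Counted-⊎ (M , f , refl) (N , g , refl) = M ℕ.+ N , ↔-sym +↔⊎ ↔-∘ (f ⊎-↔ g) , refl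

Counted-↔ : ∀ {A B v w} → A ↔ B → v ≡ w → Counted B v → Counted A w
Counted-↔ f refl (N , g , eq) = N , g ↔-∘ f , eq

module _ (k d : ℕ) (r m n : ℤ) where

  private
    Paths : ℤ → ℤ → Set
    Paths x y = L (+ k) r x y m n

    unfold : ∀ {c x y} → y ≡ + k * x - r + + c →
      Paths x y ↔ (((x , y) ≡ (m , n)) ⊎ (Paths (x + 1ℤ) y ⊎ Paths x (y + 1ℤ)))
    unfold {c} {x} refl = L-unfold {+ k} {r} (ℤₚ.i≤i+j (+ k * x - r) (+ c))

    no-east : ∀ {x y} → x + 0ℤ ≡ m → ¬ Paths (x + 1ℤ) y
    no-east {x} x≡m (s , _) =
      i+[1+j]≰i x 0 (ℤₚ.≤-trans (proj₁ (path-≤ s)) (ℤₚ.≤-reflexive (trans (sym x≡m) (ℤₚ.+-identityʳ x))))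

    no-north : ∀ {x y} → y + 0ℤ ≡ n → ¬ Paths x (y + 1ℤ)
    no-north {y = y} y≡n (s , _) =
      i+[1+j]≰i y 0 (ℤₚ.≤-trans (proj₂ (path-≤ s)) (ℤₚ.≤-reflexive (trans (sym y≡n) (ℤₚ.+-identityʳ y))))

    no-stop-x : ∀ {e x y} → x + + suc e ≡ m → (x , y) ≢ (m , n)
    no-stop-x {e} {x} x+e≡m refl = i+[1+j]≰i x e (ℤₚ.≤-reflexive x+e≡m)

    no-stop-y : ∀ {s x y} → y + + suc s ≡ n → (x , y) ≢ (m , n)
    no-stop-y {s} {y = y} y+s≡n refl = i+[1+j]≰i y s (ℤₚ.≤-reflexive y+s≡n)

    line-suc : ∀ k x r c → k * x - r + (c + k) ≡ k * (x + 1ℤ) - r + c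
    line-suc = solve-∀

    no-east-low : ∀ {c x y} → y ≡ + k * x - r + + c → c ℕ.< k → ¬ Paths (x + 1ℤ) y
    no-east-low {c} {x} refl c<k p = ℕₚ.<⇒≱ c<k (ℤₚ.drop‿+≤+ (+-cancelˡ-≤ (+ k * x - r) (subst
      (_≤ + k * x - r + + c) (line≡ (+ k) x r) (L-start {+ k} {r} p))))
      where
      line≡ : ∀ k x r → k * (x + 1ℤ) - r ≡ k * x - r + k
      line≡ = solve-∀

    next : ∀ {i e j} → i + + suc e ≡ j → i + 1ℤ + + e ≡ j
    next {i} {e} eq = trans (ℤₚ.+-assoc i 1ℤ (+ e)) eq

    east-height : ∀ {c x y} → y ≡ + k * x - r + + (c ℕ.+ k) → y ≡ + k * (x + 1ℤ) - r + + c
    east-height {c} {x} h = trans h (line-suc (+ k) x r (+ c))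

    north-height : ∀ {c x y} → y ≡ + k * x - r + + c → y + 1ℤ ≡ + k * x - r + + suc c
    north-height {c} {x} refl = raise (+ k * x - r) (+ c)
      where
      raise : ∀ u v → u + v + 1ℤ ≡ u + (1ℤ + v)
      raise = solve-∀

    east-balance : ∀ c s e → c ℕ.+ k ℕ.+ s ≡ d ℕ.+ k ℕ.* suc e → c ℕ.+ s ≡ d ℕ.+ k ℕ.* e
    east-balance c s e eq = ℕₚ.+-cancelˡ-≡ k _ _ (begin
      k ℕ.+ (c ℕ.+ s)         ≡⟨ ℕₚ.+-assoc k c s ⟨
      k ℕ.+ c ℕ.+ s           ≡⟨ cong (ℕ._+ s) (ℕₚ.+-comm k c) ⟩
      c ℕ.+ k ℕ.+ s           ≡⟨ eq ⟩
      d ℕ.+ k ℕ.* suc e       ≡⟨ cong (d ℕ.+_) (ℕₚ.*-suc k e) ⟩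
      d ℕ.+ (k ℕ.+ k ℕ.* e)   ≡⟨ ℕₚ.+-assoc d k _ ⟨
      d ℕ.+ k ℕ.+ k ℕ.* e     ≡⟨ cong (ℕ._+ k ℕ.* e) (ℕₚ.+-comm d k) ⟩
      k ℕ.+ d ℕ.+ k ℕ.* e     ≡⟨ ℕₚ.+-assoc k d _ ⟩
      k ℕ.+ (d ℕ.+ k ℕ.* e)   ∎)

    -- Decides whether an east step is allowed. `high` stores the height after it, so that matching
    -- its equation gives the form `c + k` of `altSum-pascal`.
    data Compare (c : ℕ) : Set where
      low  : c ℕ.< k → Compare c
      high : ∀ c′ → c′ ℕ.+ k ≡ c → Compare c

    compare : ∀ c → Compare c
    compare c with ℕₚ.<-≤-connex c k
    ... | inj₁ c<k = low c<k
    ... | inj₂ k≤c = high (c ∸ k) (ℕₚ.m∸n+n≡m k≤c)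

  -- e and s are the numbers of east and north steps left, c and d the heights of
  -- the starting point and of the end point above the line.
  count : ∀ e s c x y → x + + e ≡ m → y + + s ≡ n →
    y ≡ + k * x - r + + c → c ℕ.+ s ≡ d ℕ.+ k ℕ.* e →
    Counted (Paths x y) (altSum k d c e)
  -- Only the empty path is left, and `altSum k d c 0` computes to 1.
  count zero zero c x y x≡m y≡n h _ = 1 , ≡↔Fin1 end ↔-∘ (⊎-emptyʳ stuck ↔-∘ unfold h) , refl
    where
    end : (x , y) ≡ (m , n)
    end = cong₂ _,_ (trans (sym (ℤₚ.+-identityʳ x)) x≡m) (trans (sym (ℤₚ.+-identityʳ y)) y≡n)
    stuck : ¬ (Paths (x + 1ℤ) y ⊎ Paths x (y + 1ℤ))
    stuck (inj₁ p) = no-east {x} x≡m p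
    stuck (inj₂ p) = no-north {y = y} y≡n p
  -- Without east steps the sum computes to 1 at every height.
  count zero (suc s) c x y x≡m y+s≡n h bal =
    Counted-↔ (⊎-emptyˡ (no-east {x} x≡m) ↔-∘ (⊎-emptyˡ (no-stop-y y+s≡n) ↔-∘ unfold h)) refl
      (count zero s (suc c) x (y + 1ℤ) x≡m (next {y} y+s≡n) (north-height h) (trans (sym (ℕₚ.+-suc c s)) bal))
  count (suc e) s c x y x+e≡m y+s≡n h bal with compare c
  -- Impossible: with no north step left, `bal` gives `c = d + k (e + 1) ≥ k`.
  count (suc e) zero c x y x+e≡m y≡n h bal | low c<k =
    contradiction (ℕₚ.≤-trans (ℕₚ.≤-trans (ℕₚ.m≤m*n k (suc e)) (ℕₚ.m≤n+m (k ℕ.* suc e) d))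
      (ℕₚ.≤-reflexive (trans (sym bal) (ℕₚ.+-identityʳ c)))) (ℕₚ.<⇒≱ c<k)
  count (suc e) zero _ x y x+e≡m y≡n h bal | high c refl =
    Counted-↔ (⊎-emptyʳ (no-north {y = y} y≡n) ↔-∘ (⊎-emptyˡ (no-stop-x x+e≡m) ↔-∘ unfold h)) value
      (count e zero c (x + 1ℤ) y (next {x} x+e≡m) y≡n (east-height h) (east-balance c 0 e bal))
    where
    -- By `bal`, `suc (c + k)` is the height in `altSum-beyond`, so the missing north step
    -- contributes the 0 that `altSum-pascal` asks for.
    value : altSum k d c e ≡ altSum k d (c ℕ.+ k) (suc e)
    value = begin
      altSum k d c e
        ≡⟨ ℤₚ.+-identityˡ _ ⟨
      0ℤ + altSum k d c e
        ≡⟨ cong (_+ altSum k d c e) (altSum-beyond k d e) ⟨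
      altSum k d (suc (d ℕ.+ k ℕ.* suc e)) (suc e) + altSum k d c e
        ≡⟨ cong (λ z → altSum k d (suc z) (suc e) + altSum k d c e) (trans (sym bal) (ℕₚ.+-identityʳ (c ℕ.+ k))) ⟩
      altSum k d (suc (c ℕ.+ k)) (suc e) + altSum k d c e
        ≡⟨ altSum-pascal k d c e ⟩
      altSum k d (c ℕ.+ k) (suc e) ∎
  count (suc e) (suc s) c x y x+e≡m y+s≡n h bal | low c<k =
    Counted-↔ (⊎-emptyˡ (no-east-low h c<k) ↔-∘ (⊎-emptyˡ (no-stop-x x+e≡m) ↔-∘ unfold h))
      (altSum-const k d c (suc e) c<k)
      (count (suc e) s (suc c) x (y + 1ℤ) x+e≡m (next {y} y+s≡n) (north-height h)
        (trans (sym (ℕₚ.+-suc c s)) bal))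
  count (suc e) (suc s) _ x y x+e≡m y+s≡n h bal | high c refl =
    Counted-↔ (⊎-emptyˡ (no-stop-x x+e≡m) ↔-∘ unfold h)
      (trans (ℤₚ.+-comm (altSum k d c e) _) (altSum-pascal k d c e))
      (Counted-⊎
        (count e (suc s) c (x + 1ℤ) y (next {x} x+e≡m) y+s≡n (east-height h) (east-balance c (suc s) e bal))
        (count (suc e) s (suc (c ℕ.+ k)) x (y + 1ℤ) x+e≡m (next {y} y+s≡n) (north-height h)
          (trans (sym (ℕₚ.+-suc (c ℕ.+ k) s)) bal)))

-- The sum over ℚ

-- `floor` sees the reduced fraction, so the common factor `g` has to be cancelled from the integer
-- division.
floor-/ : ∀ c q → floor (+ c ℚ./ suc q) ≡ + (c ℕ./ suc q)
floor-/ c q = reduced (+ c ℚ./ suc q) ∣ gcd (+ c) (+ suc q) ∣ (ℚₚ.↥-/ (+ c) (suc q)) (ℚₚ.↧-/ (+ c) (suc q))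
  where
  reduced : ∀ p g → ↥ p * + g ≡ + c → ↧ p * + g ≡ + suc q → floor p ≡ + (c ℕ./ suc q)
  reduced (mkℚ (+ x) y _) g xg≡c yg≡1+q = begin
    1ℤ * + (x ℕ./ suc y)
      ≡⟨ ℤₚ.*-identityˡ _ ⟩
    + (x ℕ./ suc y)
      ≡⟨ cong +_ (m*n/o*n≡m/o x g (suc y)) ⟨
    + ((x ℕ.* g) ℕ./ (suc y ℕ.* g))
      ≡⟨ cong +_ (/-congʳ yg) ⟩
    + ((x ℕ.* g) ℕ./ suc q)
      ≡⟨ cong +_ (/-congˡ (ℤₚ.+-injective (trans (pos-* x g) xg≡c))) ⟩
    + (c ℕ./ suc q) ∎
    where
    yg : suc y ℕ.* g ≡ suc q
    yg = ℤₚ.+-injective (trans (pos-* (suc y) g) yg≡1+q)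
    instance
      yg≢0 : ℕ.NonZero (suc y ℕ.* g)
      yg≢0 = subst ℕ.NonZero (sym yg) _
  -- A negative numerator cannot occur: `g = 0` contradicts the positive denominator, and `g > 0`
  -- makes the product with `g` negative.
  reduced (mkℚ -[1+ _ ] y _) zero    _  yg≡1+q with () ← trans (sym (ℤₚ.*-zeroʳ (+ suc y))) yg≡1+q
  reduced (mkℚ -[1+ _ ] _ _) (suc _) () _

sumℤ : ℕ → (ℕ → ℤ) → ℤ
sumℤ zero    f = 0ℤ
sumℤ (suc n) f = f 0 + sumℤ n (f ∘ suc)

sumℤ-truncate : ∀ n l f → (∀ i → n ℕ.≤ i → f i ≡ 0ℤ) → sumℤ (n ℕ.+ l) f ≡ sumℤ n f
sumℤ-truncate zero    zero    f f≡0 = refl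
sumℤ-truncate zero    (suc l) f f≡0 =
  cong₂ _+_ (f≡0 0 z≤n) (sumℤ-truncate zero l (f ∘ suc) (λ i _ → f≡0 (suc i) z≤n))
sumℤ-truncate (suc n) l       f f≡0 =
  cong (_+_ (f 0)) (sumℤ-truncate n l (f ∘ suc) (λ i n≤i → f≡0 (suc i) (s≤s n≤i)))

-- Passing through the range of length `m + n` avoids deciding which range is longer.
sumℤ-support : ∀ m n f → (∀ i → m ℕ.≤ i → f i ≡ 0ℤ) → (∀ i → n ℕ.≤ i → f i ≡ 0ℤ) →
  sumℤ m f ≡ sumℤ n f
sumℤ-support m n f f≡0 f≡0′ = begin
  sumℤ m f           ≡⟨ sumℤ-truncate m n f f≡0 ⟨
  sumℤ (m ℕ.+ n) f   ≡⟨ cong (λ l → sumℤ l f) (ℕₚ.+-comm m n) ⟩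
  sumℤ (n ℕ.+ m) f   ≡⟨ sumℤ-truncate n m f f≡0′ ⟩
  sumℤ n f           ∎

sumTo-fromℤ : ∀ h f g → (∀ i → i ℕ.≤ h → f i ≡ fromℤ (g i)) →
  sumTo (+ h) f ≡ fromℤ (sumℤ (suc h) g)
sumTo-fromℤ h f g f≗g =
  trans (cong (foldr ℚ._+_ 0ℚ) (map-upTo f (suc h))) (go (suc h) f g λ i i<1+h → f≗g i (ℕₚ.≤-pred i<1+h))
  where
  go : ∀ n f g → (∀ i → i ℕ.< n → f i ≡ fromℤ (g i)) →
    foldr ℚ._+_ 0ℚ (applyUpTo f n) ≡ fromℤ (sumℤ n g)
  go zero    f g f≗g = refl
  go (suc n) f g f≗g = trans
    (cong₂ ℚ._+_ (f≗g 0 (s≤s z≤n)) (go n (f ∘ suc) (g ∘ suc) λ i i<n → f≗g (suc i) (s≤s i<n)))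
    (sym (fromℤ-+ (g 0) (sumℤ n (g ∘ suc))))

-- f i (e - i), and 0 for i > e.
along : ℕ → (ℕ → ℕ → ℤ) → ℕ → ℤ
along e       f zero    = f 0 e
along zero    f (suc i) = 0ℤ
along (suc e) f (suc i) = along e (f ∘ suc) i

along-≤ : ∀ f i j → along (i ℕ.+ j) f i ≡ f i j
along-≤ f zero    zero    = refl
along-≤ f zero    (suc j) = refl
along-≤ f (suc i) j       = along-≤ (f ∘ suc) i j

along-> : ∀ e f i → e ℕ.< i → along e f i ≡ 0ℤ
along-> zero    f (suc i) _         = refl
along-> (suc e) f (suc i) (s≤s e<i) = along-> e (f ∘ suc) i e<i

sumℤ-along : ∀ e f → sumℤ (suc e) (along e f) ≡ antidiagonal e f
sumℤ-along zero    f = ℤₚ.+-identityʳ (f 0 0)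
sumℤ-along (suc e) f = cong (_+_ (f 0 (suc e))) (sumℤ-along e (f ∘ suc))

≤⇒∃+ : ∀ {i j} → i ≤ j → ∃[ n ] i + + n ≡ j
≤⇒∃+ {i} {j} i≤j = ∣ j - i ∣ , (begin
  i + + ∣ j - i ∣   ≡⟨ cong (_+_ i) (ℤₚ.0≤i⇒+∣i∣≡i (ℤₚ.i≤j⇒0≤j-i i≤j)) ⟩
  i + (j - i)       ≡⟨ cancel i j ⟩
  j                 ∎)
  where
  cancel : ∀ i j → i + (j - i) ≡ j
  cancel = solve-∀

binomial-neg : ∀ x j → binomial x -[1+ j ] ≡ 0ℤ
binomial-neg (+ _)    j = refl
binomial-neg -[1+ _ ] j = refl

-- The stated sum as an alternating sum

module _ (k c d : ℕ) (r a : ℤ) where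

  private
    -- The coordinates are expressed through heights and the number of east steps, so that `a` and
    -- `r` cancel from every entry of `term`.
    b₀ = + k * a - r + + c

    m₀ n₀ : ℕ → ℤ
    m₀ e = a + + e
    n₀ e = + k * m₀ e - r + + d

  -- The quotient becomes `(d + 1) / (d + 1 + k j)` and the upper entries `d + k j + j` and
  -- `c - k i`. `raney-C` makes the quotient times the first binomial an integer; the hypothesis
  -- makes `c - k i` a natural number.
  term-inside : ∀ i j → k ℕ.* i ℕ.≤ c →
    term (+ k) r a b₀ (m₀ (i ℕ.+ j)) (n₀ (i ℕ.+ j)) i ≡ fromℤ (summand k d c i j)
  term-inside i j ki≤c = begin
    fromℤ (-1ℤ ^ i) ℚ.* (p ÷ q) ℚ.* fromℤ u ℚ.* fromℤ v
      ≡⟨ cong₂ (λ p q → fromℤ (-1ℤ ^ i) ℚ.* (p ÷ q) ℚ.* fromℤ u ℚ.* fromℤ v) p≡ q≡ ⟩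
    fromℤ (-1ℤ ^ i) ℚ.* (+ suc d ℚ./ suc (d ℕ.+ k ℕ.* j)) ℚ.* fromℤ u ℚ.* fromℤ v
      ≡⟨ cong₂ (λ u v → fromℤ (-1ℤ ^ i) ℚ.* (+ suc d ℚ./ suc (d ℕ.+ k ℕ.* j)) ℚ.* fromℤ u ℚ.* fromℤ v) u≡ v≡ ⟩
    fromℤ (-1ℤ ^ i) ℚ.* (+ suc d ℚ./ suc (d ℕ.+ k ℕ.* j)) ℚ.* fromℤ u′ ℚ.* fromℤ v′
      ≡⟨ cong (ℚ._* fromℤ v′) (ℚₚ.*-assoc (fromℤ (-1ℤ ^ i)) (+ suc d ℚ./ suc (d ℕ.+ k ℕ.* j)) (fromℤ u′)) ⟩
    fromℤ (-1ℤ ^ i) ℚ.* ((+ suc d ℚ./ suc (d ℕ.+ k ℕ.* j)) ℚ.* fromℤ u′) ℚ.* fromℤ v′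
      ≡⟨ cong (λ z → fromℤ (-1ℤ ^ i) ℚ.* z ℚ.* fromℤ v′)
           (/-*-fromℤ (+ suc d) (d ℕ.+ k ℕ.* j) u′ (raney k d j) (sym (raney-C k d j))) ⟩
    fromℤ (-1ℤ ^ i) ℚ.* fromℤ (raney k d j) ℚ.* fromℤ v′
      ≡⟨ cong (ℚ._* fromℤ v′) (fromℤ-* (-1ℤ ^ i) (raney k d j)) ⟩
    fromℤ (-1ℤ ^ i * raney k d j) ℚ.* fromℤ v′
      ≡⟨ fromℤ-* (-1ℤ ^ i * raney k d j) v′ ⟩
    fromℤ (summand k d c i j) ∎
    where
    m = m₀ (i ℕ.+ j)
    n = n₀ (i ℕ.+ j)
    p = n + r + 1ℤ - + k * m
    q = n + r + 1ℤ - + k * (a + + i)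
    u = binomial (m + n + r - (+ k + 1ℤ) * (a + + i)) (m - a - + i)
    v = binomial (b₀ + r - + k * (a + + i)) (+ i)
    u′ = + ((d ℕ.+ k ℕ.* j ℕ.+ j) C j)
    v′ = + ((c ∸ k ℕ.* i) C i)

    p≡ : p ≡ + suc d
    p≡ = ring (+ k) m r (+ d)
      where
      ring : ∀ k m r d → (k * m - r + d) + r + 1ℤ - k * m ≡ 1ℤ + d
      ring = solve-∀

    q≡ : q ≡ + suc (d ℕ.+ k ℕ.* j)
    q≡ = trans (ring (+ k) a r (+ i) (+ j) (+ d)) (cong (λ z → 1ℤ + (+ d + z)) (sym (pos-* k j)))
      where
      ring : ∀ k a r i j d → (k * (a + (i + j)) - r + d) + r + 1ℤ - k * (a + i) ≡ 1ℤ + (d + k * j)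
      ring = solve-∀

    top≡ : m + n + r - (+ k + 1ℤ) * (a + + i) ≡ + (d ℕ.+ k ℕ.* j ℕ.+ j)
    top≡ = trans (ring (+ k) a r (+ i) (+ j) (+ d)) (cong (λ z → + d + z + + j) (sym (pos-* k j)))
      where
      ring : ∀ k a r i j d →
        a + (i + j) + (k * (a + (i + j)) - r + d) + r - (k + 1ℤ) * (a + i) ≡ d + k * j + j
      ring = solve-∀

    bottom≡ : m - a - + i ≡ + j
    bottom≡ = ring a (+ i) (+ j)
      where
      ring : ∀ a i j → a + (i + j) - a - i ≡ j
      ring = solve-∀

    u≡ : u ≡ u′
    u≡ = cong₂ binomial top≡ bottom≡

    v≡ : v ≡ v′
    v≡ = cong (λ z → binomial z (+ i)) (begin
      b₀ + r - + k * (a + + i)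
        ≡⟨ ring₁ (+ k) a r (+ c) (+ i) ⟩
      + c - + k * + i
        ≡⟨ cong₂ _-_ (cong +_ (sym (ℕₚ.m+[n∸m]≡n ki≤c))) (sym (pos-* k i)) ⟩
      + (k ℕ.* i) + + (c ∸ k ℕ.* i) - + (k ℕ.* i)
        ≡⟨ ring₂ (+ (k ℕ.* i)) (+ (c ∸ k ℕ.* i)) ⟩
      + (c ∸ k ℕ.* i) ∎)
      where
      ring₁ : ∀ k a r c i → k * a - r + c + r - k * (a + i) ≡ c - k * i
      ring₁ = solve-∀
      ring₂ : ∀ x y → x + y - x ≡ y
      ring₂ = solve-∀

  -- The lower entry `m - a - i` is `- (1 + l)`, so the first binomial is 0 whatever its upper
  -- entry.
  term-outside : ∀ e l → term (+ k) r a b₀ (m₀ e) (n₀ e) (suc e ℕ.+ l) ≡ 0ℚ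
  term-outside e l = begin
    w ℚ.* fromℤ u ℚ.* fromℤ v   ≡⟨ cong (λ u → w ℚ.* fromℤ u ℚ.* fromℤ v) u≡0 ⟩
    w ℚ.* 0ℚ ℚ.* fromℤ v        ≡⟨ cong (ℚ._* fromℤ v) (ℚₚ.*-zeroʳ w) ⟩
    0ℚ ℚ.* fromℤ v              ≡⟨ ℚₚ.*-zeroˡ (fromℤ v) ⟩
    0ℚ                          ∎
    where
    i = suc e ℕ.+ l
    m = m₀ e
    n = n₀ e
    w = fromℤ (-1ℤ ^ i) ℚ.* ((n + r + 1ℤ - + k * m) ÷ (n + r + 1ℤ - + k * (a + + i)))
    u = binomial (m + n + r - (+ k + 1ℤ) * (a + + i)) (m - a - + i)
    v = binomial (b₀ + r - + k * (a + + i)) (+ i)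
    ring : ∀ a e l → a + e - a - (1ℤ + e + l) ≡ - (1ℤ + l)
    ring = solve-∀
    u≡0 : u ≡ 0ℤ
    u≡0 = trans (cong (binomial _) (ring a (+ e) (+ l))) (binomial-neg (m + n + r - (+ k + 1ℤ) * (a + + i)) l)

  private
    h = c ℕ./ suc k

    data Position (e : ℕ) : ℕ → Set where
      inside  : ∀ i j → i ℕ.+ j ≡ e → Position e i
      outside : ∀ l → Position e (suc e ℕ.+ l)

    position : ∀ e i → Position e i
    position e i with ℕₚ.≤-<-connex i e
    ... | inj₁ i≤e = inside i (e ∸ i) (ℕₚ.m+[n∸m]≡n i≤e)
    ... | inj₂ e<i = subst (Position e) (ℕₚ.m+[n∸m]≡n e<i) (outside (i ∸ suc e))

  -- The ranges `i ≤ h` and `i ≤ e` differ, but `g` vanishes past either bound: past `e` by the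
  -- default value of `along`, past `h` because of the second binomial.
  sumTo-term : ∀ e →
    sumTo (floor ((b₀ + r - + k * a) ÷ (+ k + 1ℤ))) (term (+ k) r a b₀ (m₀ e) (n₀ e))
      ≡ fromℤ (altSum k d c e)
  sumTo-term e = begin
    sumTo (floor ((b₀ + r - + k * a) ÷ (+ k + 1ℤ))) t
      ≡⟨ cong₂ (λ x y → sumTo (floor (x ÷ y)) t) (ring (+ k) a r (+ c)) (cong +_ (ℕₚ.+-comm k 1)) ⟩
    sumTo (floor (+ c ℚ./ suc k)) t
      ≡⟨ cong (λ z → sumTo z t) (floor-/ c k) ⟩
    sumTo (+ h) t
      ≡⟨ sumTo-fromℤ h t g t≗g ⟩
    fromℤ (sumℤ (suc h) g)
      ≡⟨ cong fromℤ (sumℤ-support (suc h) (suc e) g beyond-h (along-> e (summand k d c))) ⟩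
    fromℤ (sumℤ (suc e) g)
      ≡⟨ cong fromℤ (sumℤ-along e (summand k d c)) ⟩
    fromℤ (altSum k d c e) ∎
    where
    t = term (+ k) r a b₀ (m₀ e) (n₀ e)
    g = along e (summand k d c)

    ring : ∀ k a r c → k * a - r + c + r - k * a ≡ c
    ring = solve-∀

    t≗g : ∀ i → i ℕ.≤ h → t i ≡ fromℤ (g i)
    t≗g i i≤h with position e i
    ... | inside i j refl =
      trans (term-inside i j (i≤c/[1+k]⇒ki≤c c k i≤h)) (cong fromℤ (sym (along-≤ (summand k d c) i j)))
    ... | outside l = trans (term-outside e l)
      (cong fromℤ (sym (along-> e (summand k d c) (suc e ℕ.+ l) (ℕₚ.m≤m+n (suc e) l))))

    beyond-h : ∀ i → suc h ℕ.≤ i → g i ≡ 0ℤ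
    beyond-h i h<i with position e i
    ... | outside l = along-> e (summand k d c) (suc e ℕ.+ l) (ℕₚ.m≤m+n (suc e) l)
    -- Positivity of `i` matters: under truncation `c < k i + i` gives `c ∸ k i < i` only for
    -- `i > 0`.
    ... | inside i@(suc _) j refl = begin
      along (i ℕ.+ j) (summand k d c) i
        ≡⟨ along-≤ (summand k d c) i j ⟩
      -1ℤ ^ i * raney k d j * + ((c ∸ k ℕ.* i) C i)
        ≡⟨ cong (λ z → -1ℤ ^ i * raney k d j * + z) (k>n⇒nCk≡0 (ℕₚ.m<n+o⇒m∸n<o c (k ℕ.* i) (c/[1+k]<i⇒c<ki+i c k h<i))) ⟩
      -1ℤ ^ i * raney k d j * 0ℤ
        ≡⟨ ℤₚ.*-zeroʳ (-1ℤ ^ i * raney k d j) ⟩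
      0ℤ ∎

-- Both sides are the height of `(a , n)` above the line.
balance : ∀ k c d s e a r →
  + k * a - r + + c + + s ≡ + k * (a + + e) - r + + d → c ℕ.+ s ≡ d ℕ.+ k ℕ.* e
balance k c d s e a r eq = ℤₚ.+-injective (begin
  + c + + s                                          ≡⟨ ring₁ (+ k * a - r) (+ c) (+ s) ⟩
  + k * a - r + + c + + s - (+ k * a - r)            ≡⟨ cong (_- (+ k * a - r)) eq ⟩
  + k * (a + + e) - r + + d - (+ k * a - r)          ≡⟨ ring₂ (+ k) a r (+ e) (+ d) ⟩
  + d + + k * + e                                    ≡⟨ cong (_+_ (+ d)) (pos-* k e) ⟨
  + d + + (k ℕ.* e)                                  ∎)
  where
  ring₁ : ∀ x c s → c + s ≡ x + c + s - x
  ring₁ = solve-∀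
  ring₂ : ∀ k a r e d → k * (a + e) - r + d - (k * a - r) ≡ d + k * e
  ring₂ = solve-∀

theorem2p1 : (k r a b m n : ℤ) →
    k ≥ 1ℤ →
    0ℤ ≤ a → a ≤ m →
    n ≥ k * m - r →
    0ℤ ⊔ (k * a - r) ≤ b → b ≤ n →
    Σ[ N ∈ ℕ ] (L k r a b m n ↔ Fin N) ×
    (fromℤ (+ N) ≡ sumTo (floor ((b + r - k * a) ÷ (k + 1ℤ))) (term k r a b m n))
theorem2p1 (+ k) r a b m n _ _ a≤m km-r≤n ka-r≤b b≤n
  -- `k ≥ 1` has ruled out a negative `k`. The first three equations eliminate `m`, `n` and `b`; the
  -- fourth then relates two computed expressions, so it is kept and passed to `balance`.
  with ≤⇒∃+ a≤m | ≤⇒∃+ km-r≤n | ≤⇒∃+ (ℤₚ.≤-trans (ℤₚ.i≤j⊔i 0ℤ (+ k * a - r)) ka-r≤b) | ≤⇒∃+ b≤n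
... | e , refl | d , refl | c , refl | s , b+s≡n
  with count k d r m n e s c a b refl b+s≡n refl (balance k c d s e a r b+s≡n)
... | N , L↔N , N≡ = N , L↔N , trans (cong fromℤ N≡) (sym (sumTo-term k c d r a e))
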